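{- Let $n$ be a prime. For every nonnegative integer $s < n-1$, \[ \sum_{k=1}^{n-1-s} \frac{1}{k}\binom{k+s}{s} \equiv -\sum_{k=1}^{n-1-s} \frac{1}{k} \pmod{n}. \] In particular, if $n>2$, then $\sum_{k=1}^{n-1} \frac{1}{k} \equiv 0 \pmod{n}$.
   Context: For $1\le k\le n-1$, $\frac{1}{k}$ denotes the multiplicative inverse of $k$ modulo $n$ (equivalently, the congruences are congruences of rationals with denominators prime to $n$). -}

module Defs where

open import Data.Nat.Base as ℕ using (ℕ; zero; suc)
import Data.Nat.Properties as ℕ
open import Data.Nat.Coprimality as Coprimality using (prime⇒coprime; coprime-Bézout)
open import Data.Nat.GCD using (module Bézout)
open import Data.Nat.Primality using (Prime; prime⇒nonZero)
open import Data.Fin.Base using (Fin; toℕ; fromℕ<)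
open import Data.Fin.Properties using (any?; toℕ-fromℕ<)
open import Data.Integer.Base using (ℤ; +_; 0ℤ; 1ℤ; _+_; _-_; _*_; -_)
open import Data.Integer.Properties using (pos-+; pos-*)
open import Data.Integer.DivMod using (_%ℕ_; _/ℕ_; n%ℕd<d; a≡a%ℕn+[a/ℕn]*n)
open import Data.Integer.Divisibility.Signed using (_∣_; _∣?_; divides)
open import Data.Integer.Tactic.RingSolver using (solve-∀)
open import Data.Product.Base using (∃-syntax; _,_)
open import Relation.Nullary.Decidable.Core using (Dec; yes; no)
open import Relation.Nullary.Negation.Core using (contradiction)
open import Relation.Binary.PropositionalEquality

infix 4 _≡_[mod_] _≡_[mod_]?

_≡_[mod_] : ℤ → ℤ → ℕ → Set
a ≡ b [mod n ] = + n ∣ a - b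

_≡_[mod_]? : ∀ a b n → Dec (a ≡ b [mod n ])
a ≡ b [mod n ]? = + n ∣? a - b

-- ∑₁ m f = f 1 + f 2 + … + f m

∑₁ : ℕ → (ℕ → ℤ) → ℤ
∑₁ zero    f = 0ℤ
∑₁ (suc m) f = ∑₁ m f + f (suc m)

syntax ∑₁ m (λ k → e) = ∑[1≤ k ≤ m ] e

invertible? : ∀ k n → Dec (∃[ j ] + k * + toℕ {n} j ≡ 1ℤ [mod n ])
invertible? k n = any? λ j → + k * + toℕ j ≡ 1ℤ [mod n ]?

-- The multiplicative inverse of k modulo n, represented in {0,…,n-1}.
-- The value 0 is junk when k is not invertible modulo n; by 1/-inverse
-- below this does not happen for n prime and 1 ≤ k ≤ n - 1.

infix 8 1/_mod_

1/_mod_ : ℕ → ℕ → ℤ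
1/ k mod n with invertible? k n
... | yes (j , _) = + toℕ j
... | no  _       = 0ℤ

private
  integer-inverse : ∀ {k n} → Prime n → 1 ℕ.≤ k → k ℕ.< n →
                    ∃[ e ] + k * e ≡ 1ℤ [mod n ]
  integer-inverse {k@(suc _)} {n} p _ k<n
    with coprime-Bézout (Coprimality.sym (prime⇒coprime p k<n))
  ... | Bézout.+- x y eq = + x , divides (+ y) (begin
    + k * + x - 1ℤ           ≡⟨ cong (_- 1ℤ) (pos-* k x) ⟨
    + (k ℕ.* x) - 1ℤ         ≡⟨ cong (λ z → + z - 1ℤ) (trans (ℕ.*-comm k x) (sym eq)) ⟩
    + (1 ℕ.+ y ℕ.* n) - 1ℤ   ≡⟨ cong (_- 1ℤ) (pos-+ 1 (y ℕ.* n)) ⟩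
    1ℤ + + (y ℕ.* n) - 1ℤ    ≡⟨ lemma (+ (y ℕ.* n)) ⟩
    + (y ℕ.* n)              ≡⟨ pos-* y n ⟩
    + y * + n                ∎)
    where
    open ≡-Reasoning
    lemma : ∀ z → 1ℤ + z - 1ℤ ≡ z
    lemma = solve-∀
  ... | Bézout.-+ x y eq = - + x , divides (- + y) (begin
    + k * - + x - 1ℤ         ≡⟨ lemma (+ k) (+ x) ⟩
    - (1ℤ + + x * + k)       ≡⟨ cong (λ z → - (1ℤ + z)) (pos-* x k) ⟨
    - (1ℤ + + (x ℕ.* k))     ≡⟨ cong -_ (pos-+ 1 (x ℕ.* k)) ⟨
    - + (1 ℕ.+ x ℕ.* k)      ≡⟨ cong (λ z → - + z) eq ⟩
    - + (y ℕ.* n)            ≡⟨ cong -_ (pos-* y n) ⟩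
    - (+ y * + n)            ≡⟨ lemma′ (+ y) (+ n) ⟩
    - + y * + n              ∎)
    where
    open ≡-Reasoning
    lemma : ∀ a b → a * - b - 1ℤ ≡ - (1ℤ + b * a)
    lemma = solve-∀
    lemma′ : ∀ a b → - (a * b) ≡ - a * b
    lemma′ = solve-∀

  invertible : ∀ {k n} → Prime n → 1 ℕ.≤ k → k ℕ.< n →
               ∃[ j ] + k * + toℕ {n} j ≡ 1ℤ [mod n ]
  invertible {k} {n} p 1≤k k<n with integer-inverse p 1≤k k<n
  ... | e , divides q eq = fromℕ< r<n , divides (q - + k * d) (begin
    + k * + toℕ (fromℕ< r<n) - 1ℤ        ≡⟨ cong (λ z → + k * + z - 1ℤ) (toℕ-fromℕ< r<n) ⟩
    + k * + r - 1ℤ                       ≡⟨ lemma (+ k) (+ r) d (+ n) ⟩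
    + k * (+ r + d * + n) - 1ℤ - + k * d * + n
      ≡⟨ cong (λ z → + k * z - 1ℤ - + k * d * + n) (a≡a%ℕn+[a/ℕn]*n e n) ⟨
    + k * e - 1ℤ - + k * d * + n         ≡⟨ cong (_- + k * d * + n) eq ⟩
    q * + n - + k * d * + n              ≡⟨ lemma′ q (+ k * d) (+ n) ⟩
    (q - + k * d) * + n                  ∎)
    where
    open ≡-Reasoning
    instance _ = prime⇒nonZero p
    r   = e %ℕ n
    d   = e /ℕ n
    r<n = n%ℕd<d e n
    lemma : ∀ a b c m → a * b - 1ℤ ≡ a * (b + c * m) - 1ℤ - a * c * m
    lemma = solve-∀
    lemma′ : ∀ a b m → a * m - b * m ≡ (a - b) * m
    lemma′ = solve-∀

1/-inverse : ∀ {k n} → Prime n → 1 ℕ.≤ k → k ℕ.< n →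
             + k * 1/ k mod n ≡ 1ℤ [mod n ]
1/-inverse {k} {n} p 1≤k k<n with invertible? k n
... | yes (_ , eq) = eq
... | no  ¬inv     = contradiction (invertible p 1≤k k<n) ¬inv

-- Write S m s = ∑ (1/k) C(k+s, s) and H m = ∑ 1/k, both over 1 ≤ k ≤ m. Modulo
-- n the quantity S m s + H m keeps its value along the pairs with m + s = n - 1:
-- if s + 1 + m + 1 = n and v = 1/(m+1), then 1/(s+1) ≡ - v, so Pascal's rule,
-- the absorption identity (s+1) C(k+s, s+1) = k C(k+s, s) and the hockey-stick
-- identity give S m (s+1) ≡ S (m+1) s + v. At m = 0 both sums are empty. The
-- case s = 0 says 2 H (n-1) ≡ 0.
module Submission where

open import Defs
open import Data.Nat.Base using (ℕ; zero; suc; _<_; _∸_; _≤_; z≤n; s≤s) renaming (_+_ to _+ℕ_; _*_ to _*ℕ_)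
open import Data.Nat.Combinatorics using (_C_; nC1≡n; nCn≡1; nCk+nC[k+1]≡[n+1]C[k+1])
open import Data.Nat.Coprimality using (prime⇒coprime; coprime-divisor)
open import Data.Nat.Primality using (Prime)
import Data.Nat.Divisibility as ℕ
import Data.Nat.Properties as ℕ
import Data.Nat.Tactic.RingSolver as ℕ-Solver
open import Data.Integer.Base using (ℤ; +_; 0ℤ; 1ℤ; ∣_∣; _+_; _-_; _*_; -_)
open import Data.Integer.Divisibility.Signed
open import Data.Integer.Properties using (pos-+; pos-*; abs-*; neg-involutive; *-identityʳ; +-identityʳ)
open import Data.Integer.Tactic.RingSolver using (solve-∀)
open import Data.Product.Base using (_×_; _,_)
open import Relation.Binary.PropositionalEquality

-- Induction on `n`: Pascal's rule splits the left binomial, and the induction hypothesis is used at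
-- both `k` and `suc k`; one spare copy of `c` raises the factor from `suc n` to `suc (suc n)`.
[k+1]*[n+1]C[k+1]≡[n+1]*nCk : ∀ n k → suc k *ℕ (suc n C suc k) ≡ suc n *ℕ (n C k)
[k+1]*[n+1]C[k+1]≡[n+1]*nCk n zero = begin
  1 *ℕ (suc n C 1)  ≡⟨ ℕ.*-identityˡ _ ⟩
  suc n C 1         ≡⟨ nC1≡n (suc n) ⟩
  suc n             ≡⟨ ℕ.*-identityʳ (suc n) ⟨
  suc n *ℕ (n C 0)  ∎
  where open ≡-Reasoning
[k+1]*[n+1]C[k+1]≡[n+1]*nCk zero (suc k) = ℕ.*-zeroʳ (suc (suc k))
[k+1]*[n+1]C[k+1]≡[n+1]*nCk (suc n) (suc k) = begin
  suc (suc k) *ℕ (suc (suc n) C suc (suc k))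
    ≡⟨ cong (suc (suc k) *ℕ_) (nCk+nC[k+1]≡[n+1]C[k+1] (suc n) (suc k)) ⟨
  suc (suc k) *ℕ (c +ℕ (suc n C suc (suc k)))
    ≡⟨ expand k c (suc n C suc (suc k)) ⟩
  c +ℕ (suc k *ℕ c +ℕ suc (suc k) *ℕ (suc n C suc (suc k)))
    ≡⟨ cong (c +ℕ_) (cong₂ _+ℕ_ ([k+1]*[n+1]C[k+1]≡[n+1]*nCk n k)
                                ([k+1]*[n+1]C[k+1]≡[n+1]*nCk n (suc k))) ⟩
  c +ℕ (suc n *ℕ (n C k) +ℕ suc n *ℕ (n C suc k))
    ≡⟨ cong (c +ℕ_) (ℕ.*-distribˡ-+ (suc n) (n C k) (n C suc k)) ⟨
  c +ℕ suc n *ℕ ((n C k) +ℕ (n C suc k))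
    ≡⟨ cong (λ z → c +ℕ suc n *ℕ z) (nCk+nC[k+1]≡[n+1]C[k+1] n k) ⟩
  suc (suc n) *ℕ c  ∎
  where
  open ≡-Reasoning
  c = suc n C suc k
  expand : ∀ k a b → suc (suc k) *ℕ (a +ℕ b) ≡ a +ℕ (suc k *ℕ a +ℕ suc (suc k) *ℕ b)
  expand = ℕ-Solver.solve-∀

-- Adding `suc s *ℕ a` to both sides turns the left into a Pascal sum, to which the previous
-- identity applies; cancelling it avoids truncated subtraction.
[s+1]*[k+s]C[s+1]≡k*[k+s]Cs : ∀ k s → suc s *ℕ ((k +ℕ s) C suc s) ≡ k *ℕ ((k +ℕ s) C s)
[s+1]*[k+s]C[s+1]≡k*[k+s]Cs k s = ℕ.+-cancelˡ-≡ (suc s *ℕ a) _ _ (begin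
  suc s *ℕ a +ℕ suc s *ℕ b        ≡⟨ ℕ.*-distribˡ-+ (suc s) a b ⟨
  suc s *ℕ (a +ℕ b)               ≡⟨ cong (suc s *ℕ_) (nCk+nC[k+1]≡[n+1]C[k+1] (k +ℕ s) s) ⟩
  suc s *ℕ (suc (k +ℕ s) C suc s) ≡⟨ [k+1]*[n+1]C[k+1]≡[n+1]*nCk (k +ℕ s) s ⟩
  suc (k +ℕ s) *ℕ a               ≡⟨ expand k s a ⟩
  suc s *ℕ a +ℕ k *ℕ a            ∎)
  where
  open ≡-Reasoning
  a = (k +ℕ s) C s
  b = (k +ℕ s) C suc s
  expand : ∀ k s a → suc (k +ℕ s) *ℕ a ≡ suc s *ℕ a +ℕ k *ℕ a
  expand = ℕ-Solver.solve-∀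

∑₁-cong : ∀ {f g} → (∀ k → f k ≡ g k) → ∀ m → ∑₁ m f ≡ ∑₁ m g
∑₁-cong f≗g zero    = refl
∑₁-cong f≗g (suc m) = cong₂ _+_ (∑₁-cong f≗g m) (f≗g (suc m))

private
  S : (n m s : ℕ) → ℤ
  S n m s = ∑[1≤ k ≤ m ] (1/ k mod n * + ((k +ℕ s) C s))

  H : (n m : ℕ) → ℤ
  H n m = ∑[1≤ k ≤ m ] (1/ k mod n)

  pascal : ∀ n k → + (suc n C suc k) ≡ + (n C k) + + (n C suc k)
  pascal n k = trans (cong +_ (sym (nCk+nC[k+1]≡[n+1]C[k+1] n k))) (pos-+ (n C k) (n C suc k))

module _ {n : ℕ} (p : Prime n) {m s : ℕ} (m+s+2≡n : suc m +ℕ suc s ≡ n) where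

  private
    v : ℤ
    v = 1/ suc m mod n

    n≡ : + n ≡ + suc m + + suc s
    n≡ = trans (cong +_ (sym m+s+2≡n)) (pos-+ (suc m) (suc s))

    m+1<n : suc m < n
    m+1<n = subst (suc m <_) m+s+2≡n (ℕ.m<m+n (suc m) (s≤s z≤n))

    v-inverse : + n ∣ + suc m * v - 1ℤ
    v-inverse = 1/-inverse p (s≤s z≤n) m+1<n

  -- Modulo `n`, `suc s` is the negative of `suc m`, so `- v` inverts it.
  n∣[s+1]*c⇒n∣c : ∀ {c} → + n ∣ + suc s * c → + n ∣ c
  n∣[s+1]*c⇒n∣c {c} n∣ = subst (+ n ∣_) eq
    (∣m∣n⇒∣m-n (∣m∣n⇒∣m-n (∣n⇒∣m*n (c * v) ∣-refl) (∣n⇒∣m*n v n∣)) (∣n⇒∣m*n c v-inverse))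
    where
    identity : ∀ M σ c v → c * v * (M + σ) - v * (σ * c) - c * (M * v - 1ℤ) ≡ c
    identity = solve-∀
    eq : c * v * + n - v * (+ suc s * c) - c * (+ suc m * v - 1ℤ) ≡ c
    eq = trans (cong (λ z → c * v * z - v * (+ suc s * c) - c * (+ suc m * v - 1ℤ)) n≡)
               (identity (+ suc m) (+ suc s) c v)

  -- Multiply the absorption identity by `u * v`: since `+ k * u` is 1 and `+ suc s * v` is -1
  -- modulo `n`, what remains is `- (u * b)` congruent to `v * a`.
  summand-shift : ∀ {k} → 1 ≤ k → k < n →
                  + n ∣ 1/ k mod n * + ((k +ℕ s) C suc s) + v * + ((k +ℕ s) C s)
  summand-shift {k} 1≤k k<n = subst (+ n ∣_) eq
    (∣m∣n⇒∣m-n (∣m∣n⇒∣m-n (∣n⇒∣m*n (u * b * v) ∣-refl) (∣n⇒∣m*n (u * b) v-inverse))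
               (∣n⇒∣m*n (v * a) (1/-inverse p 1≤k k<n)))
    where
    open ≡-Reasoning
    u = 1/ k mod n
    a = + ((k +ℕ s) C s)
    b = + ((k +ℕ s) C suc s)
    absorption : + suc s * b ≡ + k * a
    absorption = begin
      + suc s * b                           ≡⟨ pos-* (suc s) ((k +ℕ s) C suc s) ⟨
      + (suc s *ℕ ((k +ℕ s) C suc s))       ≡⟨ cong +_ ([s+1]*[k+s]C[s+1]≡k*[k+s]Cs k s) ⟩
      + (k *ℕ ((k +ℕ s) C s))               ≡⟨ pos-* k ((k +ℕ s) C s) ⟩
      + k * a                               ∎
    identity : ∀ M σ u v a b κ →
      u * b * v * (M + σ) - u * b * (M * v - 1ℤ) - v * a * (κ * u - 1ℤ)
      ≡ u * v * (σ * b - κ * a) + (u * b + v * a)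
    identity = solve-∀
    cancel : ∀ w x z → w * (x - x) + z ≡ z
    cancel = solve-∀
    eq : u * b * v * + n - u * b * (+ suc m * v - 1ℤ) - v * a * (+ k * u - 1ℤ) ≡ u * b + v * a
    eq = begin
      u * b * v * + n - u * b * (+ suc m * v - 1ℤ) - v * a * (+ k * u - 1ℤ)
        ≡⟨ cong (λ z → u * b * v * z - u * b * (+ suc m * v - 1ℤ) - v * a * (+ k * u - 1ℤ)) n≡ ⟩
      u * b * v * (+ suc m + + suc s) - u * b * (+ suc m * v - 1ℤ) - v * a * (+ k * u - 1ℤ)
        ≡⟨ identity (+ suc m) (+ suc s) u v a b (+ k) ⟩
      u * v * (+ suc s * b - + k * a) + (u * b + v * a)
        ≡⟨ cong (λ z → u * v * (z - + k * a) + (u * b + v * a)) absorption ⟩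
      u * v * (+ k * a - + k * a) + (u * b + v * a)
        ≡⟨ cancel (u * v) (+ k * a) (u * b + v * a) ⟩
      u * b + v * a  ∎

  -- The factor C(j+s+1, s+1) - 1 is the hockey-stick sum ∑ C(k+s, s) over 1 ≤ k ≤ j.
  S-shift : ∀ j → j < n → + n ∣ (S n j (suc s) - S n j s) + v * (+ (suc (j +ℕ s) C suc s) - 1ℤ)
  S-shift zero _ = subst (+ n ∣_) (sym eq) (∣n⇒∣m*n 0ℤ ∣-refl)
    where
    identity : ∀ v → 0ℤ + v * (1ℤ - 1ℤ) ≡ 0ℤ
    identity = solve-∀
    eq : (0ℤ - 0ℤ) + v * (+ (suc s C suc s) - 1ℤ) ≡ 0ℤ
    eq = trans (cong (λ z → 0ℤ + v * (+ z - 1ℤ)) (nCn≡1 (suc s))) (identity v)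
  S-shift (suc j) j+1<n = subst (+ n ∣_) eq
    (∣m∣n⇒∣m+n (S-shift j (ℕ.<-trans (ℕ.n<1+n j) j+1<n)) (summand-shift (s≤s z≤n) j+1<n))
    where
    u = 1/ suc j mod n
    a = + (suc (j +ℕ s) C s)
    b = + (suc (j +ℕ s) C suc s)
    identity : ∀ x y u v a b →
      (x - y + v * (b - 1ℤ)) + (u * b + v * a)
      ≡ (x + u * (a + b) - (y + u * a)) + v * (a + b - 1ℤ)
    identity = solve-∀
    eq : (S n j (suc s) - S n j s + v * (b - 1ℤ)) + (u * b + v * a)
         ≡ (S n (suc j) (suc s) - S n (suc j) s) + v * (+ (suc (suc j +ℕ s) C suc s) - 1ℤ)
    -- Pascal's rule turns `a + b` into two things at once: the binomial in the last summand of
    -- `S n (suc j) (suc s)`, and the next hockey-stick factor.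
    eq = trans (identity (S n j (suc s)) (S n j s) u v a b)
      (cong₂ (λ z w → (S n j (suc s) + u * z - S n (suc j) s) + v * (w - 1ℤ))
        (trans (sym (pascal (suc (j +ℕ s)) s)) (cong (λ z → + (z C suc s)) (sym (ℕ.+-suc (suc j) s))))
        (sym (pascal (suc (j +ℕ s)) s)))

  -- By `S-shift` at `m`, the two sides differ modulo `n` by `v * (a + b)`, where `a + b` is C(n,
  -- s+1).
  S+H-step : + n ∣ S n m (suc s) + H n m → + n ∣ S n (suc m) s + H n (suc m)
  S+H-step n∣ = subst (+ n ∣_) eq
    (∣m∣n⇒∣m+n (∣m∣n⇒∣m-n n∣ (S-shift m (ℕ.<-trans (ℕ.n<1+n m) m+1<n)))
               (∣n⇒∣m*n v n∣a+b))
    where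
    a = + (suc (m +ℕ s) C s)
    b = + (suc (m +ℕ s) C suc s)
    n≡m+s+2 : suc (suc (m +ℕ s)) ≡ n
    n≡m+s+2 = trans (cong suc (sym (ℕ.+-suc m s))) m+s+2≡n
    n∣a+b : + n ∣ a + b
    -- (s+1) C(n, s+1) = n C(n-1, s), and `suc s` can be cancelled modulo `n`.
    n∣a+b = n∣[s+1]*c⇒n∣c (divides (+ (suc (m +ℕ s) C s)) (begin
      + suc s * (a + b)                           ≡⟨ cong (+ suc s *_) (pascal (suc (m +ℕ s)) s) ⟨
      + suc s * + (suc (suc (m +ℕ s)) C suc s)    ≡⟨ pos-* (suc s) _ ⟨
      + (suc s *ℕ (suc (suc (m +ℕ s)) C suc s))
        ≡⟨ cong +_ ([k+1]*[n+1]C[k+1]≡[n+1]*nCk (suc (m +ℕ s)) s) ⟩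
      + (suc (suc (m +ℕ s)) *ℕ (suc (m +ℕ s) C s)) ≡⟨ cong (λ z → + (z *ℕ (suc (m +ℕ s) C s))) n≡m+s+2 ⟩
      + (n *ℕ (suc (m +ℕ s) C s))                 ≡⟨ cong +_ (ℕ.*-comm n (suc (m +ℕ s) C s)) ⟩
      + ((suc (m +ℕ s) C s) *ℕ n)                 ≡⟨ pos-* (suc (m +ℕ s) C s) n ⟩
      a * + n                                     ∎))
      where open ≡-Reasoning
    identity : ∀ x y h v a b →
      (x + h - ((x - y) + v * (b - 1ℤ))) + v * (a + b) ≡ (y + v * a) + (h + v)
    identity = solve-∀
    eq : (S n m (suc s) + H n m - ((S n m (suc s) - S n m s) + v * (b - 1ℤ))) + v * (a + b)
         ≡ S n (suc m) s + H n (suc m)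
    eq = identity (S n m (suc s)) (S n m s) (H n m) v a b

-- The recursion lowers `m` and raises `s`, so `s` has to stay general.
n∣S+H : ∀ {n} → Prime n → ∀ m s → m +ℕ suc s ≡ n → + n ∣ S n m s + H n m
n∣S+H {n} p zero    s _  = ∣n⇒∣m*n 0ℤ (∣-refl {+ n})
n∣S+H {n} p (suc m) s eq = S+H-step p eq (n∣S+H p m (suc s) (trans (ℕ.+-suc m (suc s)) eq))

-- A prime above 2 is coprime to 2; absolute values carry the cancellation over to the naturals.
n∣x+x⇒n∣x : ∀ {n x} → Prime n → 2 < n → + n ∣ x + x → + n ∣ x
n∣x+x⇒n∣x {n} {x} p 2<n n∣x+x = ∣ᵤ⇒∣ (coprime-divisor (prime⇒coprime p 2<n)
  (subst (n ℕ.∣_) (trans (cong ∣_∣ (double x)) (abs-* (+ 2) x)) (∣⇒∣ᵤ n∣x+x)))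
  where
  double : ∀ x → x + x ≡ + 2 * x
  double = solve-∀

theorem4p1 : (n : ℕ) → Prime n →
    ((s : ℕ) → s < n ∸ 1 →
    ∑[1≤ k ≤ n ∸ 1 ∸ s ] (1/ k mod n * + ((k +ℕ s) C s)) ≡ - (∑[1≤ k ≤ n ∸ 1 ∸ s ] (1/ k mod n)) [mod n ])
    × (2 < n → ∑[1≤ k ≤ n ∸ 1 ] (1/ k mod n) ≡ 0ℤ [mod n ])
theorem4p1 n@(suc n-1) p = congruence , λ 2<n →
  subst (+ n ∣_) (sym (+-identityʳ (H n n-1)))
    -- At `s` = 0 every binomial computes to 1, so the sum `S` is `H` itself.
    (n∣x+x⇒n∣x p 2<n (subst (λ x → + n ∣ x + H n n-1)
      (∑₁-cong (λ k → *-identityʳ (1/ k mod n)) n-1)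
      (n∣S+H p n-1 0 (ℕ.+-comm n-1 1))))
  where
  congruence : ∀ s → s < n-1 → S n (n-1 ∸ s) s ≡ - H n (n-1 ∸ s) [mod n ]
  -- The congruence unfolds to a difference with `- H`, hence the double negation.
  congruence s s<n-1 = subst (λ h → + n ∣ S n (n-1 ∸ s) s + h)
    (sym (neg-involutive (H n (n-1 ∸ s))))
    (n∣S+H p (n-1 ∸ s) s
      (trans (ℕ.+-suc (n-1 ∸ s) s) (cong suc (ℕ.m∸n+n≡m (ℕ.<⇒≤ s<n-1)))))
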